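{- Let $G$ be a finite connected bipartite simple graph on $n$ vertices whose diameter $D$ is odd. Then $$Z(G) \ge \left\lceil \frac{n}{2} \right\rceil .$$
   Context: All graphs are finite, undirected, connected, without loops or multiple edges. The distance $d(x,y)$ between two vertices is the number of edges in a shortest path connecting them, and the diameter $D$ of $G$ is the maximal distance between vertices. For $0\le k\le D$, $\alpha(G,k)$ denotes the number of unordered pairs of (not necessarily distinct) vertices of $G$ at distance $k$; in particular $\alpha(G,0)=|V(G)|$ and $\alpha(G,1)=|E(G)|$. The distance to $H$-palindromicity of $G$ is $$Z(G)=\sum_{k=0}^{\lfloor D/2\rfloor}\bigl|\alpha(G,k)-\alpha(G,D-k)\bigr| .$$ -}

module Defs where

open import Data.Bool.Base using (Bool)
open import Data.Empty using (⊥-elim)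
open import Data.Fin.Base as Fin using (Fin)
import Data.Fin.Properties as Fin
open import Data.List.Base using (List; []; _∷_; length; filter; map; foldr; upTo; allFin; cartesianProduct)
open import Data.List.Relation.Unary.Unique.Propositional using (Unique)
import Data.List.Relation.Unary.Unique.DecPropositional as DecUnique
open import Data.Nat.Base using (ℕ; zero; suc; _<_; _⊔_; _∸_; ⌊_/2⌋; ∣_-_∣; _+_; _*_; s<s)
open import Data.Nat.ListAction using (sum)
import Data.Nat.Properties as ℕ
open import Data.Product.Base using (Σ; ∃; _×_; _,_; proj₁; uncurry)
open import Level using (0ℓ)
open import Relation.Binary.Core using (Rel)
import Relation.Binary.Definitions as B
open import Relation.Binary.PropositionalEquality.Core using (_≡_; _≢_; refl)
open import Relation.Nullary using (¬_; Dec; yes; no; map′; _×-dec_)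
open import Relation.Unary using (Pred; Decidable)

-- Decidability of adjacency is what makes counting possible constructively.
record SimpleGraph (n : ℕ) : Set₁ where
  field
    Adj    : Rel (Fin n) 0ℓ
    adj?   : B.Decidable Adj
    sym    : B.Symmetric Adj
    irrefl : B.Irreflexive _≡_ Adj

  data Walk : Fin n → Fin n → ℕ → Set where
    []  : ∀ {x} → Walk x x 0
    _∷_ : ∀ {x y z k} → Adj x y → Walk y z k → Walk x z (suc k)

  vertices : ∀ {x y k} → Walk x y k → List (Fin n)
  vertices {x} []      = x ∷ []
  vertices {x} (_ ∷ w) = x ∷ vertices w

  Path : Fin n → Fin n → ℕ → Set
  Path x y k = Σ (Walk x y k) λ w → Unique (vertices w)

  Connected : Set
  Connected = ∀ x y → ∃ (Path x y)

  Bipartite : Set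
  Bipartite = Σ (Fin n → Bool) λ side → ∀ {x y} → Adj x y → side x ≢ side y

  walk? : ∀ {P : Pred (List (Fin n)) 0ℓ} → Decidable P →
          ∀ x y k → Dec (Σ (Walk x y k) λ w → P (vertices w))
  walk? P? x y zero with x Fin.≟ y
  ... | no  x≢y  = no λ { ([] , _) → x≢y refl }
  ... | yes refl = map′ ([] ,_) (λ { ([] , p) → p }) (P? (x ∷ []))
  walk? P? x y (suc k) = map′
    (λ { (_ , a , w , p) → a ∷ w , p })
    (λ { (a ∷ w , p) → _ , a , w , p })
    (Fin.any? λ z → adj? x z ×-dec walk? (λ vs → P? (x ∷ vs)) z y k)

  path? : ∀ x y → Decidable (Path x y)
  path? = walk? (DecUnique.unique? Fin._≟_)

Least : Pred ℕ 0ℓ → Pred ℕ 0ℓ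
Least P k = P k × (∀ {j} → j < k → ¬ P j)

least : ∀ {P : Pred ℕ 0ℓ} → Decidable P → ∀ m → P m → ∃ (Least P)
least P? m p with P? 0
least P? m       p | yes p₀ = 0 , p₀ , λ ()
least P? zero    p | no ¬p₀ = ⊥-elim (¬p₀ p)
least P? (suc m) p | no ¬p₀ with least (λ k → P? (suc k)) m p
... | k , pk , below = suc k , pk , λ { {zero} _ → ¬p₀ ; {suc j} (s<s j<k) → below j<k }

record ConnectedGraph (n : ℕ) : Set₁ where
  field
    graph     : SimpleGraph n
    connected : SimpleGraph.Connected graph

  open SimpleGraph graph public

  shortestPath : ∀ x y → ∃ (Least (Path x y))
  shortestPath x y = uncurry (least (path? x y)) (connected x y)

  dist : Fin n → Fin n → ℕ
  dist x y = proj₁ (shortestPath x y)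

  -- Gives 0 on the empty graph, which is therefore not of odd diameter.
  diameter : ℕ
  diameter = foldr _⊔_ 0 (map (uncurry dist) (cartesianProduct (allFin n) (allFin n)))

  -- An unordered pair {x , y}, possibly with x ≡ y, is represented by its
  -- ordering with x ≤ y.
  unorderedPairs : List (Fin n × Fin n)
  unorderedPairs = filter (uncurry Fin._≤?_) (cartesianProduct (allFin n) (allFin n))

  α : ℕ → ℕ
  α k = length (filter (λ (x , y) → dist x y ℕ.≟ k) unorderedPairs)

  Z : ℕ
  Z = sum (map (λ k → ∣ α k - α (diameter ∸ k) ∣) (upTo (suc ⌊ diameter /2⌋)))

Odd : Pred ℕ 0ℓ
Odd m = ∃ λ j → m ≡ 1 + 2 * j

{-# OPTIONS --safe #-}

-- Put ε = ±1 on the two sides of the bipartition.  A walk of length k from x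
-- to y gives ε x · ε y = (-1)ᵏ, so Σ (-1)ᵏ α(k), taken over 0 ≤ k ≤ D, is the
-- sum of ε x · ε y over the unordered pairs, twice which is (Σ ε x)² + n ≥ n.
-- As D is odd, k and D - k have opposite parities; grouping them bounds the
-- alternating sum by Z, whence n ≤ 2 Z.
module Submission where

open import Defs
open import Data.Bool.Base using (Bool; true; false; if_then_else_)
open import Data.Empty using (⊥-elim)
open import Data.Fin.Base as Fin using (Fin)
import Data.Fin.Properties as Fin
open import Data.Integer.Base using (ℤ; +_; -[1+_]; 0ℤ; 1ℤ; -1ℤ; _+_; _-_; _*_; -_; _≤_; _⊖_; +≤+; -≤+)
import Data.Integer.Properties as ℤ
open import Data.Integer.Tactic.RingSolver using (solve-∀)
open import Data.List.Base using (List; []; _∷_; [_]; _++_; length; filter; map; foldr; upTo; applyUpTo; allFin; cartesianProduct)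
open import Data.List.Properties using (upTo-∷ʳ; foldr-preservesᵒ; length-tabulate)
open import Data.List.Membership.Propositional using (_∈_)
open import Data.List.Membership.Propositional.Properties using (∈-upTo⁺; ∈-upTo⁻; ∈-allFin; ∈-cartesianProduct⁺; ∈-map⁺)
open import Data.List.Relation.Unary.All as All using (All)
open import Data.List.Relation.Unary.AllPairs using (_∷_)
import Data.List.Relation.Unary.Any as Any
open import Data.List.Relation.Unary.Any using (here; there)
open import Data.List.Relation.Unary.Unique.Propositional using (Unique)
open import Data.List.Relation.Unary.Unique.Propositional.Properties using (upTo⁺; allFin⁺)
open import Data.Nat.Base as ℕ using (ℕ; zero; suc; _≥_; ⌈_/2⌉; ⌊_/2⌋; _∸_; ∣_-_∣; _⊔_; z≤n; s≤s)
open import Data.Nat.ListAction using (sum)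
import Data.Nat.Properties as ℕ
open import Data.Product.Base using (_×_; _,_; proj₁; proj₂; uncurry)
open import Data.Sum.Base as Sum using (_⊎_; inj₁; inj₂; [_,_]′)
open import Function.Base using (_∘_; id)
open import Relation.Binary.Definitions using (DecidableEquality)
open import Relation.Binary.PropositionalEquality using (_≡_; _≢_; refl; sym; trans; cong; cong₂; subst; module ≡-Reasoning)
open import Relation.Nullary using (Dec; yes; no; does)
open import Relation.Unary using (Pred; Decidable)

-- Finite sums of integers

module _ {A : Set} where

  ∑ : List A → (A → ℤ) → ℤ
  ∑ []       f = 0ℤ
  ∑ (x ∷ xs) f = f x + ∑ xs f

  ∑-cong-∈ : ∀ xs {f g : A → ℤ} → (∀ {x} → x ∈ xs → f x ≡ g x) → ∑ xs f ≡ ∑ xs g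
  ∑-cong-∈ []       eq = refl
  ∑-cong-∈ (x ∷ xs) eq = cong₂ _+_ (eq (here refl)) (∑-cong-∈ xs (eq ∘ there))

  ∑-cong : ∀ xs {f g : A → ℤ} → (∀ x → f x ≡ g x) → ∑ xs f ≡ ∑ xs g
  ∑-cong xs eq = ∑-cong-∈ xs λ {x} _ → eq x

  ∑-mono-∈ : ∀ xs {f g : A → ℤ} → (∀ {x} → x ∈ xs → f x ≤ g x) → ∑ xs f ≤ ∑ xs g
  ∑-mono-∈ []       le = ℤ.≤-refl
  ∑-mono-∈ (x ∷ xs) le = ℤ.+-mono-≤ (le (here refl)) (∑-mono-∈ xs (le ∘ there))

  ∑-0 : ∀ xs → ∑ xs (λ _ → 0ℤ) ≡ 0ℤ
  ∑-0 []       = refl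
  ∑-0 (x ∷ xs) = trans (ℤ.+-identityˡ _) (∑-0 xs)

  ∑-1 : ∀ xs → ∑ xs (λ _ → 1ℤ) ≡ + length xs
  ∑-1 []       = refl
  ∑-1 (x ∷ xs) = cong (λ s → 1ℤ + s) (∑-1 xs)

  ∑-+ : ∀ xs (f g : A → ℤ) → ∑ xs (λ x → f x + g x) ≡ ∑ xs f + ∑ xs g
  ∑-+ []       f g = refl
  ∑-+ (x ∷ xs) f g = trans (cong (λ s → f x + g x + s) (∑-+ xs f g)) (interchange (f x) (g x) _ _)
    where
    interchange : ∀ a b c d → (a + b) + (c + d) ≡ (a + c) + (b + d)
    interchange = solve-∀

  ∑-*ˡ : ∀ c xs (f : A → ℤ) → ∑ xs (λ x → c * f x) ≡ c * ∑ xs f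
  ∑-*ˡ c []       f = sym (ℤ.*-zeroʳ c)
  ∑-*ˡ c (x ∷ xs) f = trans (cong (λ s → c * f x + s) (∑-*ˡ c xs f)) (sym (ℤ.*-distribˡ-+ c (f x) _))

  ∑-*ʳ : ∀ c xs (f : A → ℤ) → ∑ xs (λ x → f x * c) ≡ ∑ xs f * c
  ∑-*ʳ c xs f = trans (∑-cong xs λ x → ℤ.*-comm (f x) c) (trans (∑-*ˡ c xs f) (ℤ.*-comm c _))

  ∑-++ : ∀ xs ys (f : A → ℤ) → ∑ (xs ++ ys) f ≡ ∑ xs f + ∑ ys f
  ∑-++ []       ys f = sym (ℤ.+-identityˡ _)
  ∑-++ (x ∷ xs) ys f = trans (cong (λ s → f x + s) (∑-++ xs ys f)) (sym (ℤ.+-assoc (f x) _ _))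

  +-sum-map : ∀ (f : A → ℕ) xs → + sum (map f xs) ≡ ∑ xs (λ x → + f x)
  +-sum-map f []       = refl
  +-sum-map f (x ∷ xs) = cong (λ s → + f x + s) (+-sum-map f xs)

∑-map : ∀ {A B : Set} (g : A → B) xs (f : B → ℤ) → ∑ (map g xs) f ≡ ∑ xs (f ∘ g)
∑-map g []       f = refl
∑-map g (x ∷ xs) f = cong (λ s → f (g x) + s) (∑-map g xs f)

∑-swap : ∀ {A B : Set} (xs : List A) (ys : List B) (f : A → B → ℤ) →
         ∑ xs (λ x → ∑ ys (f x)) ≡ ∑ ys (λ y → ∑ xs (λ x → f x y))
∑-swap []       ys f = sym (∑-0 ys)
∑-swap (x ∷ xs) ys f = trans (cong (λ s → ∑ ys (f x) + s) (∑-swap xs ys f)) (sym (∑-+ ys (f x) _))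

∑-cartesianProduct : ∀ {A B : Set} (xs : List A) (ys : List B) (f : A × B → ℤ) →
                     ∑ (cartesianProduct xs ys) f ≡ ∑ xs (λ x → ∑ ys (λ y → f (x , y)))
∑-cartesianProduct []       ys f = refl
∑-cartesianProduct (x ∷ xs) ys f =
  trans (∑-++ (map (x ,_) ys) _ f) (cong₂ _+_ (∑-map (x ,_) ys f) (∑-cartesianProduct xs ys f))

-- The Iverson bracket. It inspects only `does`, the Boolean on which `filter` branches, so one
-- `with` reduces both sides of `∑-filter`.
⟦_⟧ : ∀ {P : Set} → Dec P → ℤ
⟦ P? ⟧ = if does P? then 1ℤ else 0ℤ

∑-filter : ∀ {A : Set} {P : Pred A _} (P? : Decidable P) xs (f : A → ℤ) →
           ∑ (filter P? xs) f ≡ ∑ xs (λ x → ⟦ P? x ⟧ * f x)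
∑-filter P? []       f = refl
∑-filter P? (x ∷ xs) f with does (P? x)
... | true  = cong₂ _+_ (sym (ℤ.*-identityˡ (f x))) (∑-filter P? xs f)
... | false = trans (∑-filter P? xs f) (sym (ℤ.+-identityˡ _))

module _ {A : Set} (_≟_ : DecidableEquality A) where

  ∑-δ-∉ : ∀ {x} xs (f : A → ℤ) → All (x ≢_) xs → ∑ xs (λ y → ⟦ x ≟ y ⟧ * f y) ≡ 0ℤ
  ∑-δ-∉ {x} xs f x∉xs = trans (∑-cong-∈ xs (vanishes ∘ All.lookup x∉xs)) (∑-0 xs)
    where
    vanishes : ∀ {y} → x ≢ y → ⟦ x ≟ y ⟧ * f y ≡ 0ℤ
    vanishes {y} x≢y with x ≟ y
    ... | yes x≡y = ⊥-elim (x≢y x≡y)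
    ... | no  _   = refl

  -- Sifting by a Kronecker delta: uniqueness leaves a single surviving term, and past it `∑-δ-∉`
  -- kills the tail.
  ∑-δ : ∀ {x xs} (f : A → ℤ) → Unique xs → x ∈ xs → ∑ xs (λ y → ⟦ x ≟ y ⟧ * f y) ≡ f x
  ∑-δ {x} {_ ∷ xs} f (x∉xs ∷ _) (here refl) with x ≟ x
  ... | yes _   = trans (cong₂ _+_ (ℤ.*-identityˡ (f x)) (∑-δ-∉ xs f x∉xs)) (ℤ.+-identityʳ (f x))
  ... | no  x≢x = ⊥-elim (x≢x refl)
  ∑-δ {x} {y ∷ xs} f (y∉xs ∷ uniq) (there x∈xs) with x ≟ y
  ... | yes refl = ⊥-elim (All.lookup y∉xs x∈xs refl)
  ... | no  _    = trans (ℤ.+-identityˡ _) (∑-δ f uniq x∈xs)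

-- Sums over initial segments of the naturals

∑-applyUpTo : ∀ {A : Set} (g : ℕ → A) m (f : A → ℤ) → ∑ (applyUpTo g m) f ≡ ∑ (upTo m) (f ∘ g)
∑-applyUpTo g zero    f = refl
∑-applyUpTo g (suc m) f = cong (λ s → f (g 0) + s)
  -- The tail of `upTo (suc m)` is `applyUpTo suc m`, so the induction hypothesis serves twice, for
  -- `g ∘ suc` and for `suc`.
  (trans (∑-applyUpTo (g ∘ suc) m f) (sym (∑-applyUpTo suc m (f ∘ g))))

∑-upTo-suc : ∀ m (f : ℕ → ℤ) → ∑ (upTo (suc m)) f ≡ ∑ (upTo m) f + f m
∑-upTo-suc m f = begin
  ∑ (upTo (suc m)) f         ≡⟨ cong (λ xs → ∑ xs f) (upTo-∷ʳ m) ⟨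
  ∑ (upTo m ++ [ m ]) f      ≡⟨ ∑-++ (upTo m) [ m ] f ⟩
  ∑ (upTo m) f + (f m + 0ℤ)  ≡⟨ cong (λ s → ∑ (upTo m) f + s) (ℤ.+-identityʳ (f m)) ⟩
  ∑ (upTo m) f + f m         ∎
  where open ≡-Reasoning

-- Reading the last `b` terms backwards prepares the pairing of `k` with its mirror image when `a`
-- and `b` agree. In the induction on `b`, the last term of the range becomes the first of the
-- reversed block.
∑-upTo-fold : ∀ a b (f : ℕ → ℤ) →
              ∑ (upTo (a ℕ.+ b)) f ≡ ∑ (upTo a) f + ∑ (upTo b) (λ k → f (a ℕ.+ b ∸ suc k))
∑-upTo-fold a zero    f rewrite ℕ.+-identityʳ a = sym (ℤ.+-identityʳ _)
∑-upTo-fold a (suc b) f rewrite ℕ.+-suc a b = begin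
  ∑ (upTo (suc (a ℕ.+ b))) f               ≡⟨ ∑-upTo-suc (a ℕ.+ b) f ⟩
  ∑ (upTo (a ℕ.+ b)) f + f (a ℕ.+ b)       ≡⟨ cong (λ s → s + f (a ℕ.+ b)) (∑-upTo-fold a b f) ⟩
  ∑ (upTo a) f + ∑ (upTo b) g + f (a ℕ.+ b) ≡⟨ rotate (∑ (upTo a) f) _ _ ⟩
  ∑ (upTo a) f + (f (a ℕ.+ b) + ∑ (upTo b) g)
    ≡⟨ cong (λ s → ∑ (upTo a) f + (f (a ℕ.+ b) + s)) (∑-applyUpTo suc b (λ k → f (a ℕ.+ b ∸ k))) ⟨
  ∑ (upTo a) f + ∑ (upTo (suc b)) (λ k → f (a ℕ.+ b ∸ k)) ∎
  where
  open ≡-Reasoning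
  g : ℕ → ℤ
  g k = f (a ℕ.+ b ∸ suc k)
  rotate : ∀ x y z → x + y + z ≡ x + (z + y)
  rotate = solve-∀

-- Grouping by the value of `d`: each weight is spread over `upTo N` by a delta, which the bound on
-- `d` permits, and the two summations are exchanged.
∑-fibres : ∀ {A : Set} (d : A → ℕ) (w : ℕ → ℤ) N xs → (∀ {x} → x ∈ xs → d x ℕ.< N) →
           ∑ xs (w ∘ d) ≡ ∑ (upTo N) (λ k → w k * + length (filter (λ x → d x ℕ.≟ k) xs))
∑-fibres d w N xs d<N = begin
  ∑ xs (w ∘ d)
    ≡⟨ ∑-cong-∈ xs (λ x∈xs → ∑-δ ℕ._≟_ w (upTo⁺ N) (∈-upTo⁺ (d<N x∈xs))) ⟨
  ∑ xs (λ x → ∑ (upTo N) (λ k → ⟦ d x ℕ.≟ k ⟧ * w k))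
    ≡⟨ ∑-swap xs (upTo N) _ ⟩
  ∑ (upTo N) (λ k → ∑ xs (λ x → ⟦ d x ℕ.≟ k ⟧ * w k))
    ≡⟨ ∑-cong (upTo N) fibre ⟩
  ∑ (upTo N) (λ k → w k * + length (filter (λ x → d x ℕ.≟ k) xs)) ∎
  where
  open ≡-Reasoning
  fibre : ∀ k → ∑ xs (λ x → ⟦ d x ℕ.≟ k ⟧ * w k) ≡ w k * + length (filter (λ x → d x ℕ.≟ k) xs)
  fibre k = begin
    ∑ xs (λ x → ⟦ d x ℕ.≟ k ⟧ * w k)           ≡⟨ ∑-filter (λ x → d x ℕ.≟ k) xs (λ _ → w k) ⟨
    ∑ (filter (λ x → d x ℕ.≟ k) xs) (λ _ → w k) ≡⟨ ∑-cong (filter _ xs) (λ _ → ℤ.*-identityʳ (w k)) ⟨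
    ∑ (filter (λ x → d x ℕ.≟ k) xs) (λ _ → w k * 1ℤ) ≡⟨ ∑-*ˡ (w k) (filter _ xs) (λ _ → 1ℤ) ⟩
    w k * ∑ (filter (λ x → d x ℕ.≟ k) xs) (λ _ → 1ℤ) ≡⟨ cong (λ s → w k * s) (∑-1 (filter _ xs)) ⟩
    w k * + length (filter (λ x → d x ℕ.≟ k) xs) ∎

-- Sums over unordered pairs

-- Inclusion-exclusion for two alternatives that cover everything, with `R` as their conjunction.
indicator-+ : ∀ {P Q R : Set} (P? : Dec P) (Q? : Dec Q) (R? : Dec R) →
              P ⊎ Q → (P → Q → R) → (R → P × Q) → ⟦ P? ⟧ + ⟦ Q? ⟧ ≡ 1ℤ + ⟦ R? ⟧
indicator-+ (yes _) (yes _) (yes _) _   _  _  = refl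
indicator-+ (yes _) (no _)  (no _)  _   _  _  = refl
indicator-+ (no _)  (yes _) (no _)  _   _  _  = refl
indicator-+ (yes p) (yes q) (no ¬r) _   ∧⇒ _  = ⊥-elim (¬r (∧⇒ p q))
indicator-+ (no ¬p) _       (yes r) _   _  ⇒∧ = ⊥-elim (¬p (proj₁ (⇒∧ r)))
indicator-+ (yes _) (no ¬q) (yes r) _   _  ⇒∧ = ⊥-elim (¬q (proj₂ (⇒∧ r)))
indicator-+ (no ¬p) (no ¬q) (no _)  p∨q _  _  = ⊥-elim ([ ¬p , ¬q ]′ p∨q)

≤-indicators : ∀ {n} (x y : Fin n) → ⟦ x Fin.≤? y ⟧ + ⟦ y Fin.≤? x ⟧ ≡ 1ℤ + ⟦ x Fin.≟ y ⟧
≤-indicators x y = indicator-+ (x Fin.≤? y) (y Fin.≤? x) (x Fin.≟ y)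
  (Fin.≤-total x y) Fin.≤-antisym λ { refl → ℕ.≤-refl , ℕ.≤-refl }

-- The triangles `x ≤ y` and `y ≤ x` together cover the square and overlap exactly in the diagonal.
∑-unordered : ∀ n (F : Fin n → Fin n → ℤ) → (∀ x y → F x y ≡ F y x) →
  let V = allFin n
      S = ∑ (filter (uncurry Fin._≤?_) (cartesianProduct V V)) (uncurry F)
  in S + S ≡ ∑ V (λ x → ∑ V (F x)) + ∑ V (λ x → F x x)
∑-unordered n F F-sym = begin
  S + S
    -- The second copy of `S` is transposed, so that it runs over the opposite triangle.
    ≡⟨ cong₂ _+_ S≡ (trans S≡ (∑-swap V V _)) ⟩
  ∑ V (λ x → ∑ V (λ y → ⟦ x Fin.≤? y ⟧ * F x y)) + ∑ V (λ x → ∑ V (λ y → ⟦ y Fin.≤? x ⟧ * F y x))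
    ≡⟨ ∑-+ V _ _ ⟨
  ∑ V (λ x → ∑ V (λ y → ⟦ x Fin.≤? y ⟧ * F x y) + ∑ V (λ y → ⟦ y Fin.≤? x ⟧ * F y x))
    ≡⟨ ∑-cong V row ⟩
  ∑ V (λ x → ∑ V (F x) + F x x)
    ≡⟨ ∑-+ V _ _ ⟩
  ∑ V (λ x → ∑ V (F x)) + ∑ V (λ x → F x x) ∎
  where
  open ≡-Reasoning
  V = allFin n
  S = ∑ (filter (uncurry Fin._≤?_) (cartesianProduct V V)) (uncurry F)

  S≡ : S ≡ ∑ V (λ x → ∑ V (λ y → ⟦ x Fin.≤? y ⟧ * F x y))
  S≡ = trans (∑-filter (uncurry Fin._≤?_) (cartesianProduct V V) (uncurry F)) (∑-cartesianProduct V V _)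

  entry : ∀ x y → ⟦ x Fin.≤? y ⟧ * F x y + ⟦ y Fin.≤? x ⟧ * F y x ≡ F x y + ⟦ x Fin.≟ y ⟧ * F x y
  entry x y = begin
    ⟦ x Fin.≤? y ⟧ * F x y + ⟦ y Fin.≤? x ⟧ * F y x ≡⟨ cong (λ s → ⟦ x Fin.≤? y ⟧ * F x y + ⟦ y Fin.≤? x ⟧ * s) (F-sym y x) ⟩
    ⟦ x Fin.≤? y ⟧ * F x y + ⟦ y Fin.≤? x ⟧ * F x y ≡⟨ ℤ.*-distribʳ-+ (F x y) ⟦ x Fin.≤? y ⟧ ⟦ y Fin.≤? x ⟧ ⟨
    (⟦ x Fin.≤? y ⟧ + ⟦ y Fin.≤? x ⟧) * F x y       ≡⟨ cong (λ s → s * F x y) (≤-indicators x y) ⟩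
    (1ℤ + ⟦ x Fin.≟ y ⟧) * F x y                    ≡⟨ ℤ.*-distribʳ-+ (F x y) 1ℤ ⟦ x Fin.≟ y ⟧ ⟩
    1ℤ * F x y + ⟦ x Fin.≟ y ⟧ * F x y              ≡⟨ cong (λ s → s + ⟦ x Fin.≟ y ⟧ * F x y) (ℤ.*-identityˡ (F x y)) ⟩
    F x y + ⟦ x Fin.≟ y ⟧ * F x y                   ∎

  row : ∀ x → ∑ V (λ y → ⟦ x Fin.≤? y ⟧ * F x y) + ∑ V (λ y → ⟦ y Fin.≤? x ⟧ * F y x) ≡ ∑ V (F x) + F x x
  row x = begin
    ∑ V (λ y → ⟦ x Fin.≤? y ⟧ * F x y) + ∑ V (λ y → ⟦ y Fin.≤? x ⟧ * F y x) ≡⟨ ∑-+ V _ _ ⟨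
    ∑ V (λ y → ⟦ x Fin.≤? y ⟧ * F x y + ⟦ y Fin.≤? x ⟧ * F y x)             ≡⟨ ∑-cong V (entry x) ⟩
    ∑ V (λ y → F x y + ⟦ x Fin.≟ y ⟧ * F x y)                               ≡⟨ ∑-+ V _ _ ⟩
    ∑ V (F x) + ∑ V (λ y → ⟦ x Fin.≟ y ⟧ * F x y)                           ≡⟨ cong (λ s → ∑ V (F x) + s) (∑-δ Fin._≟_ (F x) (allFin⁺ n) (∈-allFin x)) ⟩
    ∑ V (F x) + F x x                                                       ∎

0≤i*i : ∀ i → 0ℤ ≤ i * i
0≤i*i (+ n)    = subst (0ℤ ≤_) (ℤ.pos-* n n) (+≤+ z≤n)
0≤i*i -[1+ n ] = +≤+ z≤n

-- The full double sum factors as the square of `∑ V ε`, hence is nonnegative; the diagonal supplies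
-- the `n`.
n≤2∑εε : ∀ n (ε : Fin n → ℤ) → (∀ x → ε x * ε x ≡ 1ℤ) →
  let V = allFin n
      S = ∑ (filter (uncurry Fin._≤?_) (cartesianProduct V V)) (λ (x , y) → ε x * ε y)
  in + n ≤ S + S
n≤2∑εε n ε ε² = begin
  + n                         ≡⟨ ℤ.+-identityˡ (+ n) ⟨
  0ℤ + + n                    ≤⟨ ℤ.+-monoˡ-≤ (+ n) (0≤i*i (∑ V ε)) ⟩
  ∑ V ε * ∑ V ε + + n         ≡⟨ cong₂ _+_ square diagonal ⟨
  ∑ V (λ x → ∑ V (λ y → ε x * ε y)) + ∑ V (λ x → ε x * ε x) ≡⟨ ∑-unordered n (λ x y → ε x * ε y) (λ x y → ℤ.*-comm (ε x) (ε y)) ⟨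
  _                           ∎
  where
  open ℤ.≤-Reasoning
  V = allFin n
  square : ∑ V (λ x → ∑ V (λ y → ε x * ε y)) ≡ ∑ V ε * ∑ V ε
  square = trans (∑-cong V λ x → ∑-*ˡ (ε x) V ε) (∑-*ʳ (∑ V ε) V ε)
  diagonal : ∑ V (λ x → ε x * ε x) ≡ + n
  diagonal = trans (∑-cong V ε²) (trans (∑-1 V) (cong +_ (length-tabulate id)))

-- Alternating signs

sgn : ℕ → ℤ
sgn zero    = 1ℤ
sgn (suc k) = - sgn k

sgn≡±1 : ∀ k → sgn k ≡ 1ℤ ⊎ sgn k ≡ -1ℤ
sgn≡±1 zero    = inj₁ refl
sgn≡±1 (suc k) = Sum.swap (Sum.map (cong (-_)) (cong (-_)) (sgn≡±1 k))

-- A sign is its own inverse, so the quotient of signs is a product; lowering `m` and `k` together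
-- cancels two negations.
sgn-∸ : ∀ {m k} → k ℕ.≤ m → sgn (m ∸ k) ≡ sgn m * sgn k
sgn-∸         z≤n                 = sym (ℤ.*-identityʳ _)
sgn-∸ {suc m} {suc k} (s≤s k≤m) = trans (sgn-∸ k≤m) (neg-neg (sgn m) (sgn k))
  where
  neg-neg : ∀ a b → a * b ≡ (- a) * (- b)
  neg-neg = solve-∀

sgn-odd : ∀ j → sgn (1 ℕ.+ 2 ℕ.* j) ≡ -1ℤ
sgn-odd zero    = refl
-- The rewrite brings the second new successor to the front, and the two resulting negations cancel.
sgn-odd (suc j) rewrite ℕ.+-suc j (j ℕ.+ 0) = trans (ℤ.neg-involutive _) (sgn-odd j)

m⊖n≤∣m-n∣ : ∀ m n → m ⊖ n ≤ + ∣ m - n ∣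
m⊖n≤∣m-n∣ zero    zero    = ℤ.≤-refl
m⊖n≤∣m-n∣ zero    (suc n) = -≤+
m⊖n≤∣m-n∣ (suc m) zero    = ℤ.≤-refl
m⊖n≤∣m-n∣ (suc m) (suc n) = subst (_≤ + ∣ m - n ∣) (sym (ℤ.[1+m]⊖[1+n]≡m⊖n m n)) (m⊖n≤∣m-n∣ m n)

+m-+n≤∣m-n∣ : ∀ m n → + m - + n ≤ + ∣ m - n ∣
+m-+n≤∣m-n∣ m n = subst (_≤ + ∣ m - n ∣) (sym (ℤ.m-n≡m⊖n m n)) (m⊖n≤∣m-n∣ m n)

-- The sign only decides which way round the difference is taken, and the absolute value dominates
-- both. The factor `-1ℤ * s` is the shape in which `sgn (D ∸ k)` arrives for odd `D`.
signed-difference-≤ : ∀ {s} a b → s ≡ 1ℤ ⊎ s ≡ -1ℤ → s * + a + -1ℤ * s * + b ≤ + ∣ a - b ∣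
signed-difference-≤ a b (inj₁ refl) = subst (_≤ + ∣ a - b ∣) (simplify (+ a) (+ b)) (+m-+n≤∣m-n∣ a b)
  where
  simplify : ∀ x y → x - y ≡ 1ℤ * x + -1ℤ * 1ℤ * y
  simplify = solve-∀
signed-difference-≤ a b (inj₂ refl)
  rewrite ℕ.∣-∣-comm a b = subst (_≤ + ∣ b - a ∣) (simplify (+ a) (+ b)) (+m-+n≤∣m-n∣ b a)
  where
  simplify : ∀ x y → y - x ≡ -1ℤ * x + -1ℤ * -1ℤ * y
  simplify = solve-∀

-- For odd `D` the `D + 1` terms fold into two halves with no middle term left over. The half length
-- `h` is exactly the number of summands on the right, and each mirror pair carries opposite signs.
alternating-sum-≤ : ∀ (a : ℕ → ℕ) {D} → Odd D →
  ∑ (upTo (suc D)) (λ k → sgn k * + a k) ≤ + sum (map (λ k → ∣ a k - a (D ∸ k) ∣) (upTo (suc ⌊ D /2⌋)))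
alternating-sum-≤ a {D} (j , refl) = begin
  ∑ (upTo (suc D)) f
    ≡⟨ cong (λ m → ∑ (upTo m) f) 1+D≡h+h ⟩
  ∑ (upTo (h ℕ.+ h)) f
    ≡⟨ ∑-upTo-fold h h f ⟩
  ∑ (upTo h) f + ∑ (upTo h) (λ k → f (h ℕ.+ h ∸ suc k))
    -- With `suc D` in place of `h + h`, the mirror index computes to `D ∸ k`.
    ≡⟨ cong (λ m → ∑ (upTo h) f + ∑ (upTo h) (λ k → f (m ∸ suc k))) 1+D≡h+h ⟨
  ∑ (upTo h) f + ∑ (upTo h) (λ k → f (D ∸ k))
    ≡⟨ ∑-+ (upTo h) f _ ⟨
  ∑ (upTo h) (λ k → f k + f (D ∸ k))
    ≤⟨ ∑-mono-∈ (upTo h) (bound ∘ ∈-upTo⁻) ⟩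
  ∑ (upTo h) (λ k → + ∣ a k - a (D ∸ k) ∣)
    ≡⟨ +-sum-map (λ k → ∣ a k - a (D ∸ k) ∣) (upTo h) ⟨
  + sum (map (λ k → ∣ a k - a (D ∸ k) ∣) (upTo h)) ∎
  where
  open ℤ.≤-Reasoning
  h = suc ⌊ D /2⌋
  f : ℕ → ℤ
  f k = sgn k * + a k

  ⌊D/2⌋≡j : ⌊ D /2⌋ ≡ j
  -- Rounding up half of `j + j` is by definition rounding down half of its successor, which is `D`.
  ⌊D/2⌋≡j rewrite ℕ.+-identityʳ j = sym (ℕ.n≡⌈n+n/2⌉ j)

  1+D≡h+h : suc D ≡ h ℕ.+ h
  1+D≡h+h rewrite ⌊D/2⌋≡j | ℕ.+-identityʳ j = cong suc (sym (ℕ.+-suc j j))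

  bound : ∀ {k} → k ℕ.< h → f k + f (D ∸ k) ≤ + ∣ a k - a (D ∸ k) ∣
  bound {k} (s≤s k≤⌊D/2⌋) = subst (λ s → f k + s * + a (D ∸ k) ≤ + ∣ a k - a (D ∸ k) ∣)
    -- As `k ≤ D`, the subtraction is not truncated, and its sign is `sgn D * sgn k` with `sgn D`
    -- equal to `-1ℤ`.
    (sym (trans (sgn-∸ (ℕ.≤-trans k≤⌊D/2⌋ (ℕ.⌊n/2⌋≤n D))) (cong (λ s → s * sgn k) (sgn-odd j))))
    (signed-difference-≤ (a k) (a (D ∸ k)) (sgn≡±1 k))

-- Bipartite graphs

sideSign : Bool → ℤ
sideSign true  = 1ℤ
sideSign false = -1ℤ

sideSign² : ∀ b → sideSign b * sideSign b ≡ 1ℤ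
sideSign² true  = refl
sideSign² false = refl

sideSign-≢ : ∀ {b c} → b ≢ c → sideSign b ≡ - sideSign c
sideSign-≢ {true}  {false} _   = refl
sideSign-≢ {false} {true}  _   = refl
sideSign-≢ {true}  {true}  b≢c = ⊥-elim (b≢c refl)
sideSign-≢ {false} {false} b≢c = ⊥-elim (b≢c refl)

module _ {n} (G : SimpleGraph n) (bip : SimpleGraph.Bipartite G) where
  open SimpleGraph G using (Walk; []; _∷_)

  ε : Fin n → ℤ
  ε = sideSign ∘ proj₁ bip

  -- Each edge changes sides and contributes one factor -1; the empty walk leaves the square of a
  -- sign.
  walk-sign : ∀ {x y k} → Walk x y k → ε x * ε y ≡ sgn k
  walk-sign {x} [] = sideSign² (proj₁ bip x)
  walk-sign {x} {z} (_∷_ {y = y} xy w) = begin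
    ε x * ε z         ≡⟨ cong (λ s → s * ε z) (sideSign-≢ (proj₂ bip xy)) ⟩
    (- ε y) * ε z     ≡⟨ ℤ.neg-distribˡ-* (ε y) (ε z) ⟨
    - (ε y * ε z)     ≡⟨ cong (-_) (walk-sign w) ⟩
    _                 ∎
    where open ≡-Reasoning

-- Distances, the diameter and the final bound

≤-foldr-⊔ : ∀ {m xs} → m ∈ xs → m ℕ.≤ foldr _⊔_ 0 xs
≤-foldr-⊔ {m} {xs} m∈xs = foldr-preservesᵒ
  (λ x y → [ ℕ.m≤n⇒m≤n⊔o y , ℕ.m≤n⇒m≤o⊔n x ]′) 0 xs (inj₂ (Any.map ℕ.≤-reflexive m∈xs))

module _ {n} (G : ConnectedGraph n) where
  open ConnectedGraph G

  dist≤diameter : ∀ x y → dist x y ℕ.≤ diameter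
  dist≤diameter x y =
    ≤-foldr-⊔ (∈-map⁺ (uncurry dist) (∈-cartesianProduct⁺ (∈-allFin x) (∈-allFin y)))

  -- The alternating sum of `α`, bounded above by `Z`, is also the sum of `ε x * ε y` over unordered
  -- pairs, whose double is at least `n`.
  n≤2Z : Bipartite → Odd diameter → n ℕ.≤ Z ℕ.+ Z
  n≤2Z bip odd = ℤ.drop‿+≤+ (ℤ.≤-trans (n≤2∑εε n (ε graph bip) (sideSign² ∘ proj₁ bip)) (ℤ.+-mono-≤ S≤Z S≤Z))
    where
    open ℤ.≤-Reasoning
    S≤Z : ∑ unorderedPairs (λ (x , y) → ε graph bip x * ε graph bip y) ≤ + Z
    S≤Z = begin
      ∑ unorderedPairs (λ (x , y) → ε graph bip x * ε graph bip y)
        -- A shortest path is in particular a walk of length `dist x y`.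
        ≡⟨ ∑-cong unorderedPairs (λ (x , y) → walk-sign graph bip (proj₁ (proj₁ (proj₂ (shortestPath x y))))) ⟩
      ∑ unorderedPairs (sgn ∘ uncurry dist)
        -- `upTo` excludes its bound, so `suc diameter` is what admits pairs at distance `diameter`.
        ≡⟨ ∑-fibres (uncurry dist) sgn (suc diameter) unorderedPairs (λ {(x , y)} _ → s≤s (dist≤diameter x y)) ⟩
      ∑ (upTo (suc diameter)) (λ k → sgn k * + α k)
        ≤⟨ alternating-sum-≤ α odd ⟩
      + Z ∎

theorem1 : (n : ℕ) (G : ConnectedGraph n) → ConnectedGraph.Bipartite G → Odd (ConnectedGraph.diameter G) → ConnectedGraph.Z G ≥ ⌈ n /2⌉
-- Rounding up halves is monotone, and half of `Z + Z` is `Z` itself.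
theorem1 n G bip odd = subst (⌈ n /2⌉ ℕ.≤_) (sym (ℕ.n≡⌈n+n/2⌉ (ConnectedGraph.Z G))) (ℕ.⌈n/2⌉-mono (n≤2Z G bip odd))
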